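{- Let $\Gamma$ be a finite set of relations on a finite set $A$, and suppose that $\mathrm{Pol}(\Gamma)$ is $r$-switchable. Let $\Psi=\exists y_1\forall x_1\exists y_2\forall x_2\dots\exists y_n\forall x_n\,\Phi$, where $\Phi$ is a conjunctive formula over $\Gamma$. Then $\Psi$ holds if and only if for every $k$ with $0\le k\le r$ and all integers $1\le n_1<n_2<\dots<n_k\le n$, the sentence $\omega_{n_1,\dots,n_k}(\Psi)$ holds.
   Context: A conjunctive formula over $\Gamma$ is a conjunction of atoms $R(v_1,\dots,v_m)$ with $R\in\Gamma$ and each $v_i$ a variable, here among $x_1,\dots,x_n,y_1,\dots,y_n$. All quantifiers range over $A$. $\mathrm{Pol}(\Gamma)$ is the set of all finitary operations on $A$ preserving every relation of $\Gamma$. A tuple $(a_1,\dots,a_N)$ has a switch in the $i$-th position ($2\le i\le N$) if $a_{i-1}\ne a_i$. A set $F$ of operations on $A$ is $r$-switchable if for every $N$ the set $A^N$ is generated, using operations of $F$ applied coordinatewise, from the set of all tuples of $A^N$ with at most $r$ switches. The transformation $\omega$: let $0=n_0<n_1<\dots<n_k<n_{k+1}=n+1$. Define the mapping $\omega_{n_1,\dots,n_k}\colon\{x_1,\dots,x_n,y_1,\dots,y_n\}\to\{x_1,\dots,x_n,y_1,\dots,y_n,z_0,z_1,\dots,z_k\}$ by $\omega_{n_1,\dots,n_k}(y_i)=y_i$ for every $i$; $\omega_{n_1,\dots,n_k}(x_{n_j})=x_{n_j}$ for $1\le j\le k$; and $\omega_{n_1,\dots,n_k}(x_i)=z_j$ if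 $n_j<i<n_{j+1}$. Then $\omega_{n_1,\dots,n_k}(\Psi)$ is the sentence obtained from $\Psi$ as follows: (1) every variable $u$ is replaced by the variable $\omega_{n_1,\dots,n_k}(u)$; (2) the quantification $\forall x_i$ is removed whenever $\omega_{n_1,\dots,n_k}(x_i)\ne x_i$; (3) the outer quantification $\forall z_0\forall z_1\dots\forall z_k$ is added at the front. For $k=0$ the list $n_1,\dots,n_k$ is empty and all $x_i$ are replaced by $z_0$. -}

module Defs where

open import Data.Bool.Base using (if_then_else_)
open import Data.Fin.Base using (Fin; zero; suc; toℕ; _<_)
open import Data.Fin.Properties as Fin using (<-cmp; <-trans)
open import Data.List.Base as List using (List; []; _∷_; _++_)
import Data.List.Relation.Unary.All as ListAll
open import Data.Nat.Base as ℕ using (ℕ; zero; suc; z≤n; s≤s)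
open import Data.Product.Base as Product using (_×_; _,_)
open import Data.Sum.Base using (_⊎_; inj₁; inj₂)
import Data.Sum.Properties as Sum
open import Data.Vec.Base as Vec using (Vec; []; _∷_; lookup; transpose)
open import Data.Vec.Relation.Unary.All using (All)
open import Data.Vec.Relation.Unary.Linked as Linked using (Linked)
open import Data.Vec.Relation.Unary.Linked.Properties using (lookup⁺)
open import Level using (0ℓ)
open import Relation.Binary.Definitions using (DecidableEquality; tri<; tri≈; tri>)
open import Relation.Binary.PropositionalEquality using (_≡_; refl; cong)
open import Relation.Nullary.Decidable using (does)
open import Relation.Nullary.Negation using (contradiction)
open import Relation.Unary using (Pred)

------------------------------------------------------------------------
-- Relations, polymorphisms and switchability

record Language (A : Set) : Set₁ where
  field
    size  : ℕ
    arity : Fin size → ℕ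
    rel   : (R : Fin size) → Pred (Vec A (arity R)) 0ℓ

open Language public

Operation : Set → ℕ → Set
Operation A m = Vec A m → A

OperationSet : Set → Set₁
OperationSet A = ∀ {m} → Pred (Operation A m) 0ℓ

module _ {A : Set} where

  coordinatewise : ∀ {m N} → Operation A m → Vec (Vec A N) m → Vec A N
  coordinatewise f ts = Vec.map f (transpose ts)

  Preserves : ∀ {m q} → Operation A m → Pred (Vec A q) 0ℓ → Set
  Preserves f R = ∀ ts → All R ts → R (coordinatewise f ts)

  Pol : Language A → OperationSet A
  Pol Γ f = ∀ R → Preserves f (rel Γ R)

  data Generated (F : OperationSet A) {N : ℕ} (S : Pred (Vec A N) 0ℓ)
                 : Pred (Vec A N) 0ℓ where
    generator : ∀ {t} → S t → Generated F S t
    apply     : ∀ {m} {f : Operation A m} → F f →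
                ∀ {ts} → All (Generated F S) ts →
                Generated F S (coordinatewise f ts)

  module _ (_≟_ : DecidableEquality A) where

    switches : ∀ {N} → Vec A N → ℕ
    switches []           = 0
    switches (_ ∷ [])     = 0
    switches (a ∷ b ∷ as) =
      if does (a ≟ b) then switches (b ∷ as) else suc (switches (b ∷ as))

    Switchable : ℕ → OperationSet A → Set
    Switchable r F =
      ∀ N (t : Vec A N) → Generated F (λ s → switches s ℕ.≤ r) t

------------------------------------------------------------------------
-- Prenex sentences with named variables

data Quantifier : Set where
  all ex : Quantifier

record Atom {A : Set} (Γ : Language A) (V : Set) : Set where
  constructor atom
  field
    symbol : Fin (size Γ)
    args   : Vec V (arity Γ symbol)

ConjunctiveFormula : {A : Set} → Language A → Set → Set
ConjunctiveFormula Γ V = List (Atom Γ V)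

record Sentence {A : Set} (Γ : Language A) (V : Set) : Set where
  constructor _∙_
  field
    prefix : List (Quantifier × V)
    matrix : ConjunctiveFormula Γ V

module _ {A : Set} {Γ : Language A} {V : Set} where

  satisfies : (V → A) → ConjunctiveFormula Γ V → Set
  satisfies ρ = ListAll.All λ (atom R vs) → rel Γ R (Vec.map ρ vs)

  module _ (_≟_ : DecidableEquality V) where

    _[_≔_] : (V → A) → V → A → V → A
    (ρ [ v ≔ a ]) u = if does (u ≟ v) then a else ρ u

    evaluate : List (Quantifier × V) → ConjunctiveFormula Γ V → (V → A) → Set
    evaluate []              Φ ρ = satisfies ρ Φ
    evaluate ((all , v) ∷ p) Φ ρ = ∀ a → evaluate p Φ (ρ [ v ≔ a ])
    evaluate ((ex  , v) ∷ p) Φ ρ = Product.∃ λ a → evaluate p Φ (ρ [ v ≔ a ])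

    -- The initial assignment is irrelevant when, as below, every variable of
    -- the matrix is quantified.
    Holds : Sentence Γ V → Set
    Holds (p ∙ Φ) = ∀ ρ → evaluate p Φ ρ

------------------------------------------------------------------------
-- The variables x₁,…,xₙ, y₁,…,yₙ and l further variables z₀,…,z_{l-1}.
-- The index i : Fin n of an x or y stands for the number toℕ i + 1.

Var : ℕ → ℕ → Set
Var n l = Fin n ⊎ Fin n ⊎ Fin l

pattern x i = inj₁ i
pattern y i = inj₂ (inj₁ i)
pattern z j = inj₂ (inj₂ j)

_≟ᵛ_ : ∀ {n l} → DecidableEquality (Var n l)
_≟ᵛ_ = Sum.≡-dec Fin._≟_ (Sum.≡-dec Fin._≟_ Fin._≟_)

include : ∀ {n l} → Var n 0 → Var n l
include (x i) = x i
include (y i) = y i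

∃∀-prefix : ∀ n → List (Quantifier × Var n 0)
∃∀-prefix n = List.concatMap (λ i → (ex , y i) ∷ (all , x i) ∷ []) (List.allFin n)

------------------------------------------------------------------------
-- The transformation ω

shift : ∀ {n l} → Var n l → Var n (suc l)
shift (x i) = x i
shift (y i) = y i
shift (z j) = z (suc j)

-- For strictly increasing ns, the lemmas ωˣ-at and ωˣ-between below are the
-- two clauses that define ω on the variables x i.
ωˣ : ∀ {n k} → Vec (Fin n) k → Fin n → Var n (suc k)
ωˣ []       i = z zero
ωˣ (m ∷ ms) i with <-cmp i m
... | tri< _ _ _ = z zero
... | tri≈ _ _ _ = x i
... | tri> _ _ _ = shift (ωˣ ms i)

ωᵛ : ∀ {n k} → Vec (Fin n) k → Var n 0 → Var n (suc k)
ωᵛ ns (x i) = ωˣ ns i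
ωᵛ ns (y i) = y i

ω : ∀ {A : Set} {Γ : Language A} {n k} → Vec (Fin n) k →
    Sentence Γ (Var n 0) → Sentence Γ (Var n (suc k))
ω {k = k} ns (p ∙ Φ) =
  (List.map (λ j → all , z j) (List.allFin (suc k)) ++
   List.map (Product.map₂ (ωᵛ ns))
            (List.filter (λ (_ , u) → ωᵛ ns u ≟ᵛ include u) p))
  ∙ List.map (λ (atom R vs) → atom R (Vec.map (ωᵛ ns) vs)) Φ

ωˣ-at : ∀ {n k} {ns : Vec (Fin n) k} → Linked _<_ ns →
        ∀ j → ωˣ ns (lookup ns j) ≡ x (lookup ns j)
ωˣ-at {ns = m ∷ ms} _   zero with <-cmp m m
... | tri< _ m≢m _ = contradiction refl m≢m
... | tri≈ _ _ _   = refl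
... | tri> _ m≢m _ = contradiction refl m≢m
ωˣ-at {ns = m ∷ ms} inc (suc j) with <-cmp (lookup ms j) m
... | tri< _ _ ≯m = contradiction (lookup⁺ <-trans {i = zero} {suc j} inc (s≤s z≤n)) ≯m
... | tri≈ _ _ ≯m = contradiction (lookup⁺ <-trans {i = zero} {suc j} inc (s≤s z≤n)) ≯m
... | tri> _ _ _  = cong shift (ωˣ-at (Linked.tail inc) j)

-- n_j < i < n_{j+1}, where n_l is lookup ns (l - 1).
ωˣ-between : ∀ {n k} (ns : Vec (Fin n) k) i (j : Fin (suc k)) →
             (∀ l → toℕ l ℕ.< toℕ j → lookup ns l < i) →
             (∀ l → toℕ j ℕ.≤ toℕ l → i < lookup ns l) →
             ωˣ ns i ≡ z j
ωˣ-between []       i zero    _  _ = refl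
ωˣ-between (m ∷ ms) i zero    lo hi with <-cmp i m
... | tri< _ _ _   = refl
... | tri≈ i≮m _ _ = contradiction (hi zero z≤n) i≮m
... | tri> i≮m _ _ = contradiction (hi zero z≤n) i≮m
ωˣ-between (m ∷ ms) i (suc j) lo hi with <-cmp i m
... | tri< _ _ m≮i = contradiction (lo zero (s≤s z≤n)) m≮i
... | tri≈ _ _ m≮i = contradiction (lo zero (s≤s z≤n)) m≮i
... | tri> _ _ _   = cong shift (ωˣ-between ms i j
                       (λ l l<j → lo (suc l) (s≤s l<j))
                       (λ l j≤l → hi (suc l) (s≤s j≤l)))

{-# OPTIONS --safe #-}

-- A labelling s assigns to every move a of the universal player at every level
-- i a value s i a; ∃ wins under s if it has a strategy for the game in which
-- the move a at level i sets x i to s i a.  Winning is preserved by Pol Γ,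
-- because strategies can be combined coordinatewise.  List s level by level:
-- if it has at most r switches, they occur at k ≤ r levels n₁ < … < n_k, and
-- all labels strictly between n_j and n_{j+1} equal some z_j, so a strategy for ω n₁…n_k(Ψ) with these z's wins under s.  By
-- switchability ∃ wins under every labelling, in particular under s i a = a,
-- which is Ψ.  Conversely a strategy for Ψ can be used in ω n₁…n_k(Ψ) by
-- playing z_j for the missing x's.

module Submission where

open import Defs
open import Data.Bool.Base using (if_then_else_)
open import Data.Fin.Base using (Fin; zero; suc; _<_; combine; remQuot)
open import Data.Fin.Properties using (inj⇒≟; <-cmp; suc-injective; remQuot-combine)
open import Data.List.Base as List using (List; []; _∷_; _++_)
open import Data.List.Properties using (filter-accept; filter-reject)
import Data.List.Relation.Unary.All as ListAll
import Data.List.Relation.Unary.All.Properties as ListAllₚ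
open import Data.Nat.Base using (ℕ; zero; suc; _≤_; _*_; z≤n; s≤s)
open import Data.Nat.Properties using (≤-refl; ≤-trans; ≤-reflexive; n≤1+n)
open import Data.Product.Base as Product using (_×_; _,_; proj₁; proj₂; ∃)
open import Data.Sum.Base using (_⊎_; inj₁; inj₂; [_,_]′)
open import Data.Sum.Properties using (inj₁-injective; inj₂-injective)
open import Data.Vec.Base as Vec using (Vec; []; _∷_; lookup; tabulate; transpose; replicate; splitAt)
open import Data.Vec.Properties using
  (lookup-map; map-∘; map-cong; lookup-++ˡ; lookup-++ʳ; lookup-⊛; lookup-replicate;
   lookup∘tabulate; tabulate-cong)
open import Data.Vec.Relation.Binary.Pointwise.Extensional using (ext; Pointwise-≡⇒≡)
import Data.Vec.Relation.Unary.All as VecAll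
import Data.Vec.Relation.Unary.All.Properties as VecAllₚ
open import Data.Vec.Relation.Unary.Linked as Linked using (Linked; []; [-]; _∷_)
import Data.Vec.Relation.Unary.Linked.Properties as Linkedₚ
open import Function.Base using (_∘_; id; const)
open import Function.Bundles using (_↔_; _⇔_; mk⇔; Equivalence; Inverse)
open import Function.Properties.Inverse using (↔⇒↣)
open import Relation.Binary.Definitions using (DecidableEquality; tri<; tri≈; tri>)
open import Relation.Binary.PropositionalEquality using
  (_≡_; _≢_; _≗_; refl; sym; trans; cong; cong₂; cong-app; subst; module ≡-Reasoning)
open import Relation.Nullary.Decidable using (yes; no; dec-true; dec-false)
open import Relation.Nullary.Negation using (contradiction)

open Equivalence using (to; from)

private variable
  A V W : Set
  Γ : Language A
  k l m n N w : ℕ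

-- The game in which ∃ and ∀ alternately choose the entries of two vectors

Play : (A : Set) (n : ℕ) → (Vec A n → Vec A n → Set) → Set
Play A zero    P = P [] []
Play A (suc n) P = ∃ λ b → ∀ a → Play A n (λ as bs → P (a ∷ as) (b ∷ bs))

Play-map : {P Q : Vec A n → Vec A n → Set} →
           (∀ as bs → P as bs → Q as bs) → Play A n P → Play A n Q
Play-map {n = zero}  h p       = h [] [] p
Play-map {n = suc n} h (b , p) =
  b , λ a → Play-map (λ as bs → h (a ∷ as) (b ∷ bs)) (p a)

-- At level i, ∃ follows the given strategy as though the move `a` had been `s i a`. This respects
-- the order of play, because the label depends only on the level and on the move just made.
Play-relabel : {P : Vec A n → Vec A n → Set} (s : Fin n → A → A) → Play A n P →
               Play A n (λ as bs → P (tabulate (λ i → s i (lookup as i))) bs)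
Play-relabel {n = zero}  s p       = p
Play-relabel {n = suc n} s (b , p) = b , λ a → Play-relabel (s ∘ suc) (p (s zero a))

-- The m strategies run in parallel against the same moves, and `f` is applied to their answers at
-- each level. The separate plays are retained as `bss`, because `P j` speaks of them and not of the
-- combined play.
Play-combine : (f : Operation A m) {P : Fin m → Vec A n → Vec A n → Set} →
               (∀ j → Play A n (P j)) →
               Play A n (λ as bs → ∃ λ (bss : Fin m → Vec A n) →
                 (∀ i → lookup bs i ≡ f (tabulate λ j → lookup (bss j) i)) ×
                 (∀ j → P j as (bss j)))
Play-combine {n = zero}  f p = (λ _ → []) , (λ ()) , p
Play-combine {n = suc n} f {P} p =
  f (tabulate (proj₁ ∘ p)) , λ a → Play-map {n = n}
    (λ as bs (bss , eq , q) →
      (λ j → proj₁ (p j) ∷ bss j) ,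
      (λ { zero → refl ; (suc i) → eq i }) ,
      q)
    (Play-combine {n = n} f {λ j as bs → P j (a ∷ as) (proj₁ (p j) ∷ bs)}
      (λ j → proj₂ (p j) a))

-- Satisfaction of conjunctive formulas

lookup-transpose : (ts : Vec (Vec A N) m) (i : Fin N) →
                   lookup (transpose ts) i ≡ tabulate λ j → lookup (lookup ts j) i
lookup-transpose []                   i = lookup-replicate i []
lookup-transpose {A} {m = suc m} (t ∷ ts) i = begin
  lookup (replicate _ cons Vec.⊛ t Vec.⊛ transpose ts) i
    ≡⟨ lookup-⊛ i (replicate _ cons Vec.⊛ t) (transpose ts) ⟩
  lookup (replicate _ cons Vec.⊛ t) i (lookup (transpose ts) i)
    ≡⟨ cong-app (lookup-⊛ i (replicate _ cons) t) (lookup (transpose ts) i) ⟩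
  lookup (replicate _ cons) i (lookup t i) (lookup (transpose ts) i)
    ≡⟨ cong₂ (λ g → g (lookup t i)) (lookup-replicate i cons) (lookup-transpose ts i) ⟩
  lookup t i ∷ tabulate (λ j → lookup (lookup ts j) i) ∎
  where
  open ≡-Reasoning
  cons : A → Vec A m → Vec A (suc m)
  cons = _∷_

lookup-coordinatewise : (f : Operation A m) (ts : Vec (Vec A N) m) (i : Fin N) →
  lookup (coordinatewise f ts) i ≡ f (tabulate λ j → lookup (lookup ts j) i)
lookup-coordinatewise f ts i =
  trans (lookup-map i f (transpose ts)) (cong f (lookup-transpose ts i))

satisfies-cong : {ρ ρ′ : V → A} → ρ ≗ ρ′ → (Φ : ConjunctiveFormula Γ V) →
                 satisfies ρ Φ → satisfies ρ′ Φ
satisfies-cong {Γ = Γ} eq Φ =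
  ListAll.map (λ {(atom R vs)} → subst (rel Γ R) (map-cong eq vs))

-- For each atom, its tuples of values under the assignments `ρ j` form the rows of `ts`. All rows
-- lie in the relation, so `Preserves` applies to them.
satisfies-Pol : {f : Operation A m} → Pol Γ f → {ρ : Fin m → V → A}
                (Φ : ConjunctiveFormula Γ V) → (∀ j → satisfies (ρ j) Φ) →
                satisfies (λ v → f (tabulate λ j → ρ j v)) Φ
satisfies-Pol f∈Pol [] h = ListAll.[]
satisfies-Pol {Γ = Γ} {f = f} f∈Pol {ρ} (atom R vs ∷ Φ) h =
  subst (rel Γ R) (Pointwise-≡⇒≡ (ext pointwise))
        (f∈Pol R ts (VecAllₚ.tabulate⁺ (ListAll.head ∘ h)))
  ListAll.∷ satisfies-Pol f∈Pol Φ (ListAll.tail ∘ h)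
  where
  open ≡-Reasoning
  ts : Vec (Vec _ _) _
  ts = tabulate λ j → Vec.map (ρ j) vs
  pointwise : ∀ i → lookup (coordinatewise f ts) i ≡
                    lookup (Vec.map (λ v → f (tabulate λ j → ρ j v)) vs) i
  pointwise i = begin
    lookup (coordinatewise f ts) i
      ≡⟨ lookup-coordinatewise f ts i ⟩
    f (tabulate λ j → lookup (lookup ts j) i)
      ≡⟨ cong f (tabulate-cong λ j → trans
           (cong (λ t → lookup t i) (lookup∘tabulate (λ j → Vec.map (ρ j) vs) j))
           (lookup-map i (ρ j) vs)) ⟩
    f (tabulate λ j → ρ j (lookup vs i))
      ≡⟨ lookup-map i _ vs ⟨
    lookup (Vec.map (λ v → f (tabulate λ j → ρ j v)) vs) i ∎

substitute : (V → W) → ConjunctiveFormula Γ V → ConjunctiveFormula Γ W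
substitute θ = List.map λ (atom R vs) → atom R (Vec.map θ vs)

satisfies-substitute : {θ : V → W} {ρ : W → A} (Φ : ConjunctiveFormula Γ V) →
                       satisfies ρ (substitute θ Φ) ⇔ satisfies (ρ ∘ θ) Φ
satisfies-substitute {Γ = Γ} {θ = θ} {ρ} Φ = mk⇔
  (λ s → ListAll.map (λ {(atom R vs)} → subst (rel Γ R) (sym (map-∘ ρ θ vs)))
                     (ListAllₚ.map⁻ s))
  (λ s → ListAllₚ.map⁺
    (ListAll.map (λ {(atom R vs)} → subst (rel Γ R) (map-∘ ρ θ vs)) s))

-- Evaluation of prenex sentences

module _ {V : Set} (_≟_ : DecidableEquality V) {A : Set} {Γ : Language A} where

  private
    _⟨_≔_⟩ : (V → A) → V → A → V → A
    _⟨_≔_⟩ = _[_≔_] {Γ = Γ} _≟_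

  update-same : ∀ ρ v a → (ρ ⟨ v ≔ a ⟩) v ≡ a
  update-same ρ v a rewrite dec-true (v ≟ v) refl = refl

  update-other : ∀ ρ {u v} a → u ≢ v → (ρ ⟨ v ≔ a ⟩) u ≡ ρ u
  update-other ρ {u} {v} a u≢v rewrite dec-false (u ≟ v) u≢v = refl

  update-self : ∀ ρ v → ρ ⟨ v ≔ ρ v ⟩ ≗ ρ
  update-self ρ v u with u ≟ v
  ... | yes refl = refl
  ... | no  _    = refl

  update-cong : ∀ ρ ρ′ u v a → ρ u ≡ ρ′ u → (ρ ⟨ v ≔ a ⟩) u ≡ (ρ′ ⟨ v ≔ a ⟩) u
  update-cong ρ ρ′ u v a eq with u ≟ v
  ... | yes _ = refl
  ... | no  _ = eq

  -- Agreement on the range of θ suffices, so a quantifier over a variable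
  -- outside that range can be dropped.
  evaluate-cong : {U : Set} {θ : U → V} (p : List (Quantifier × V)) (Φ : ConjunctiveFormula Γ U)
                  {ρ ρ′ : V → A} → ρ ∘ θ ≗ ρ′ ∘ θ →
                  evaluate _≟_ p (substitute θ Φ) ρ → evaluate _≟_ p (substitute θ Φ) ρ′
  evaluate-cong []              Φ eq e =
    from (satisfies-substitute Φ) (satisfies-cong eq Φ (to (satisfies-substitute Φ) e))
  evaluate-cong {θ = θ} ((all , v) ∷ p) Φ {ρ} {ρ′} eq e       = λ a →
    evaluate-cong p Φ (λ u → update-cong ρ ρ′ (θ u) v a (eq u)) (e a)
  evaluate-cong {θ = θ} ((ex  , v) ∷ p) Φ {ρ} {ρ′} eq (a , e) =
    a , evaluate-cong p Φ (λ u → update-cong ρ ρ′ (θ u) v a (eq u)) e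

  module _ {J : Set} (v : J → V) {p : List (Quantifier × V)} where

    evaluate-∀⁺ : {Φ : ConjunctiveFormula Γ V} (js : List J) →
                  (∀ ρ → evaluate _≟_ p Φ ρ) →
                  ∀ ρ → evaluate _≟_ (List.map (λ j → all , v j) js ++ p) Φ ρ
    evaluate-∀⁺ []       e ρ = e ρ
    evaluate-∀⁺ (j ∷ js) e ρ = λ a → evaluate-∀⁺ js e (ρ ⟨ v j ≔ a ⟩)

    evaluate-∀⁻ : {U : Set} {θ : U → V} (Φ : ConjunctiveFormula Γ U) (js : List J) {ρ : V → A} →
                  evaluate _≟_ (List.map (λ j → all , v j) js ++ p) (substitute θ Φ) ρ →
                  evaluate _≟_ p (substitute θ Φ) ρ
    evaluate-∀⁻         Φ []       e     = e
    evaluate-∀⁻ {θ = θ} Φ (j ∷ js) {ρ} e =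
      -- The quantifier is instantiated at the value that its variable already has. The update then
      -- changes nothing, but only pointwise; `evaluate-cong` carries this equality through the
      -- prefix.
      evaluate-cong p Φ (λ u → update-self ρ (v j) (θ u)) (evaluate-∀⁻ Φ js (e (ρ (v j))))

-- Alternating prefixes read as plays

assign : (Fin n → A) → (Fin n → A) → (Fin l → A) → Var n l → A
assign f g h = [ f , [ g , h ]′ ]′

∃∀-block : Fin n → List (Quantifier × Var n l)
∃∀-block i = (ex , y i) ∷ (all , x i) ∷ []

module _ {A : Set} (Γ : Language A) {n l : ℕ} where

  private
    _⟨_≔_⟩ : (Var n l → A) → Var n l → A → Var n l → A
    _⟨_≔_⟩ = _[_≔_] {Γ = Γ} _≟ᵛ_

  -- The assignment that `evaluate` reaches at the end of an alternating prefix. The map `e` sends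
  -- the m remaining levels to their variable indices, so that recursion can descend through the
  -- prefix while n stays fixed.
  updates : (Var n l → A) → (Fin m → Fin n) → Vec A m → Vec A m → Var n l → A
  updates ρ e []       []       = ρ
  updates ρ e (a ∷ as) (b ∷ bs) =
    updates ((ρ ⟨ y (e zero) ≔ b ⟩) ⟨ x (e zero) ≔ a ⟩) (e ∘ suc) as bs

  updates-fresh : ∀ ρ v (e : Fin m → Fin n) as bs →
                  (∀ j → v ≢ x (e j)) → (∀ j → v ≢ y (e j)) →
                  updates ρ e as bs v ≡ ρ v
  updates-fresh ρ v e []       []       v≢x v≢y = refl
  updates-fresh ρ v e (a ∷ as) (b ∷ bs) v≢x v≢y =
    trans (updates-fresh _ v (e ∘ suc) as bs (v≢x ∘ suc) (v≢y ∘ suc))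
   (trans (update-other _≟ᵛ_ {Γ = Γ} (ρ ⟨ y (e zero) ≔ b ⟩) a (v≢x zero))
          (update-other _≟ᵛ_ {Γ = Γ} ρ b (v≢y zero)))

  updates-x : ∀ ρ (e : Fin m → Fin n) → (∀ {i j} → e i ≡ e j → i ≡ j) →
              ∀ as bs i → updates ρ e as bs (x (e i)) ≡ lookup as i
  updates-x ρ e inj (a ∷ as) (b ∷ bs) zero    = trans
    (updates-fresh _ (x (e zero)) (e ∘ suc) as bs
      (λ j eq → contradiction (inj (inj₁-injective eq)) λ ()) (λ j ()))
    (update-same _≟ᵛ_ {Γ = Γ} (ρ ⟨ y (e zero) ≔ b ⟩) (x (e zero)) a)
  updates-x ρ e inj (a ∷ as) (b ∷ bs) (suc i) =
    updates-x _ (e ∘ suc) (suc-injective ∘ inj) as bs i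

  updates-y : ∀ ρ (e : Fin m → Fin n) → (∀ {i j} → e i ≡ e j → i ≡ j) →
              ∀ as bs i → updates ρ e as bs (y (e i)) ≡ lookup bs i
  updates-y ρ e inj (a ∷ as) (b ∷ bs) zero    =
    trans (updates-fresh _ (y (e zero)) (e ∘ suc) as bs (λ j ())
            (λ j eq → contradiction (inj (inj₁-injective (inj₂-injective eq))) λ ()))
   (trans (update-other _≟ᵛ_ {Γ = Γ} (ρ ⟨ y (e zero) ≔ b ⟩) {y (e zero)} {x (e zero)} a (λ ()))
          (update-same _≟ᵛ_ {Γ = Γ} ρ (y (e zero)) b))
  updates-y ρ e inj (a ∷ as) (b ∷ bs) (suc i) =
    updates-y _ (e ∘ suc) (suc-injective ∘ inj) as bs i

  updates≗assign : ∀ ρ as bs →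
    updates ρ id as bs ≗ assign (lookup as) (lookup bs) (λ j → ρ (z j))
  updates≗assign ρ as bs (x i) = updates-x ρ id id as bs i
  updates≗assign ρ as bs (y i) = updates-y ρ id id as bs i
  updates≗assign ρ as bs (z j) = updates-fresh ρ (z j) id as bs (λ _ ()) (λ _ ())

evaluate-∃∀ : (e : Fin m → Fin n) (Φ : ConjunctiveFormula Γ (Var n l)) (ρ : Var n l → A) →
              evaluate _≟ᵛ_ (List.concatMap ∃∀-block (List.tabulate e)) Φ ρ ⇔
              Play A m (λ as bs → satisfies (updates Γ ρ e as bs) Φ)
evaluate-∃∀ {m = zero}  e Φ ρ = mk⇔ id id
evaluate-∃∀ {m = suc m} e Φ ρ = mk⇔
  (λ (b , h) → b , λ a → to   (evaluate-∃∀ (e ∘ suc) Φ _) (h a))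
  (λ (b , h) → b , λ a → from (evaluate-∃∀ (e ∘ suc) Φ _) (h a))

-- `Holds` ranges over all initial assignments; a strategy is extracted at the constant one given by
-- the element of `A`. The prefix overwrites it entirely.
Holds-∃∀ : (Φ : ConjunctiveFormula Γ (Var n 0)) → A →
           Holds {A = A} _≟ᵛ_ (∃∀-prefix n ∙ Φ) ⇔
           Play A n (λ as bs → satisfies (assign (lookup as) (lookup bs) (λ ())) Φ)
Holds-∃∀ {Γ = Γ} Φ a₀ = mk⇔
  (λ h → Play-map (λ as bs → satisfies-cong (agree (const a₀) as bs) Φ)
                  (to (evaluate-∃∀ id Φ (const a₀)) (h (const a₀))))
  (λ p ρ → from (evaluate-∃∀ id Φ ρ)
    (Play-map (λ as bs → satisfies-cong (λ v → sym (agree ρ as bs v)) Φ) p))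
  where
  agree : ∀ ρ as bs → updates Γ ρ id as bs ≗ assign (lookup as) (lookup bs) (λ ())
  agree ρ as bs (x i) = updates≗assign Γ ρ as bs (x i)
  agree ρ as bs (y i) = updates≗assign Γ ρ as bs (y i)
  agree ρ as bs (z ())

-- The transformation ω

shift-x : {v : Var n l} {j : Fin n} → shift v ≡ x j → v ≡ x j
shift-x {v = x _} refl = refl
shift-x {v = y _} ()
shift-x {v = z _} ()

-- This shows that a dropped variable `x i` is outside the range of `ωᵛ ns`: nothing but `x i`
-- itself could be mapped to it.
ωˣ-x : (ns : Vec (Fin n) k) {i j : Fin n} → ωˣ ns i ≡ x j → i ≡ j
ωˣ-x (m ∷ ns) {i} eq with <-cmp i m
... | tri≈ _ _ _ = inj₁-injective eq
... | tri> _ _ _ = ωˣ-x ns (shift-x eq)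

module _ {A : Set} {Γ : Language A} {n k : ℕ} (ns : Vec (Fin n) k)
         (Φ : ConjunctiveFormula Γ (Var n 0)) where

  private
    kept : List (Quantifier × Var n 0) → List (Quantifier × Var n (suc k))
    kept p = List.map (Product.map₂ (ωᵛ ns))
                      (List.filter (λ (_ , u) → ωᵛ ns u ≟ᵛ include u) p)

    prefix′ : (Fin m → Fin n) → List (Quantifier × Var n 0)
    prefix′ e = List.concatMap ∃∀-block (List.tabulate e)

    Φω : ConjunctiveFormula Γ (Var n (suc k))
    Φω = substitute (ωᵛ ns) Φ

    _⟨_≔_⟩ : (Var n (suc k) → A) → Var n (suc k) → A → Var n (suc k) → A
    _⟨_≔_⟩ = _[_≔_] {Γ = Γ} _≟ᵛ_

  kept-y : ∀ i p → kept ((ex , y i) ∷ p) ≡ (ex , y i) ∷ kept p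
  kept-y i p = cong (List.map _)
    (filter-accept (λ (_ , u) → ωᵛ ns u ≟ᵛ include u) {x = ex , y i} {xs = p} refl)

  update-unread : ∀ {i} → ωˣ ns i ≢ x i → ∀ ρ a → (ρ ⟨ x i ≔ a ⟩) ∘ ωᵛ ns ≗ ρ ∘ ωᵛ ns
  update-unread     neq ρ a (x j) = update-other _≟ᵛ_ {Γ = Γ} ρ a
    (λ eq → neq (subst (λ i → ωˣ ns i ≡ _) (ωˣ-x ns eq) eq))
  update-unread {i} neq ρ a (y j) = update-other _≟ᵛ_ {Γ = Γ} ρ {y j} {x i} a (λ ())

  -- The play on the right has a universal move at every level, also where the quantifier is
  -- dropped; the new matrix does not read those moves. Thus all choices of `ns` lead to games of
  -- the same shape.
  evaluate-ω : (e : Fin m → Fin n) (ρ : Var n (suc k) → A) →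
               evaluate _≟ᵛ_ (kept (prefix′ e)) Φω ρ ⇔
               Play A m (λ as bs → satisfies (updates Γ ρ e as bs) Φω)
  evaluate-ω {m = zero}  e ρ = mk⇔ id id
  evaluate-ω {m = suc m} e ρ
    rewrite kept-y (e zero) ((all , x (e zero)) ∷ prefix′ (e ∘ suc))
    with ωˣ ns (e zero) ≟ᵛ x (e zero)
  ... | yes eq rewrite eq = mk⇔
    (λ (b , h) → b , λ a → to   (evaluate-ω (e ∘ suc) _) (h a))
    (λ (b , h) → b , λ a → from (evaluate-ω (e ∘ suc) _) (h a))
  ... | no neq = mk⇔
    (λ (b , h) → b , λ a → to (evaluate-ω (e ∘ suc) _)
      (evaluate-cong _≟ᵛ_ (kept (prefix′ (e ∘ suc))) Φ
        (λ u → sym (update-unread neq (ρ ⟨ y (e zero) ≔ b ⟩) a u)) h))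
    -- The play awaits a move that the sentence lacks. Any element will do, and the answer `b` is
    -- one at hand.
    (λ (b , h) → b , evaluate-cong _≟ᵛ_ (kept (prefix′ (e ∘ suc))) Φ
      (update-unread neq (ρ ⟨ y (e zero) ≔ b ⟩) b) (from (evaluate-ω (e ∘ suc) _) (h b)))

  Holds-ω : Holds _≟ᵛ_ (ω ns (∃∀-prefix n ∙ Φ)) ⇔
            (∀ (c : Fin (suc k) → A) →
             Play A n (λ as bs → satisfies (assign (lookup as) (lookup bs) c ∘ ωᵛ ns) Φ))
  Holds-ω = mk⇔
    -- Only the values at the z's survive the play, which overwrites every x and y; `c zero` is a
    -- filler.
    (λ h c → let ρ = assign (const (c zero)) (const (c zero)) c in Play-map
      (λ as bs s → satisfies-cong (updates≗assign Γ ρ as bs ∘ ωᵛ ns) Φ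
                                  (to (satisfies-substitute Φ) s))
      (to (evaluate-ω id ρ)
          (evaluate-∀⁻ _≟ᵛ_ (λ j → z j) Φ (List.allFin (suc k)) (h ρ))))
    (λ p → evaluate-∀⁺ _≟ᵛ_ (λ j → z j) (List.allFin (suc k)) λ ρ →
      from (evaluate-ω id ρ) (Play-map
        (λ as bs s → from (satisfies-substitute Φ)
          (satisfies-cong (λ u → sym (updates≗assign Γ ρ as bs (ωᵛ ns u))) Φ s))
        (p (λ j → ρ (z j)))))

-- Labellings with few switches

assign-shift : (f g : Fin n → A) (h : Fin (suc l) → A) (v : Var n l) →
               assign f g h (shift v) ≡ assign f g (h ∘ suc) v
assign-shift f g h (x _) = refl
assign-shift f g h (y _) = refl
assign-shift f g h (z _) = refl

-- `ωˣ ns i` is `x i` or some `z j`, so of all values of `f` only `f i` can be read. This makes the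
-- value a function of the level and its own move, as `Play-relabel` demands.
assign-ωˣ : (ns : Vec (Fin n) k) (f g : Fin n → A) (h : Fin (suc k) → A) (i : Fin n) →
            assign (const (f i)) (const (f i)) h (ωˣ ns i) ≡ assign f g h (ωˣ ns i)
assign-ωˣ []       f g h i = refl
assign-ωˣ (m ∷ ns) f g h i with <-cmp i m
... | tri< _ _ _ = refl
... | tri≈ _ _ _ = refl
... | tri> _ _ _ = trans (assign-shift (const (f i)) (const (f i)) h (ωˣ ns i))
  (trans (assign-ωˣ ns f g (h ∘ suc) i) (sym (assign-shift f g h (ωˣ ns i))))

-- A new first level raises every index by one and keeps the order. The two variables have different
-- types, so their values are compared.
assign-ωˣ-suc : (f g : Fin (suc n) → A) (ns : Vec (Fin n) k) (h : Fin (suc k) → A) (i : Fin n) →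
                assign f g h (ωˣ (Vec.map suc ns) (suc i)) ≡
                assign (f ∘ suc) (g ∘ suc) h (ωˣ ns i)
assign-ωˣ-suc f g []       h i = refl
assign-ωˣ-suc f g (m ∷ ns) h i with <-cmp i m
... | tri< _ _ _ = refl
... | tri≈ _ _ _ = refl
... | tri> _ _ _ = begin
  assign f g h (shift (ωˣ (Vec.map suc ns) (suc i)))
    ≡⟨ assign-shift f g h (ωˣ (Vec.map suc ns) (suc i)) ⟩
  assign f g (h ∘ suc) (ωˣ (Vec.map suc ns) (suc i))
    ≡⟨ assign-ωˣ-suc f g ns (h ∘ suc) i ⟩
  assign (f ∘ suc) (g ∘ suc) (h ∘ suc) (ωˣ ns i)
    ≡⟨ assign-shift (f ∘ suc) (g ∘ suc) h (ωˣ ns i) ⟨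
  assign (f ∘ suc) (g ∘ suc) h (shift (ωˣ ns i)) ∎
  where open ≡-Reasoning

ωˣ-map-suc-zero : (ns : Vec (Fin n) k) → ωˣ (Vec.map suc ns) zero ≡ z zero
ωˣ-map-suc-zero []       = refl
ωˣ-map-suc-zero (_ ∷ ns) = refl

Linked-map-suc : {ns : Vec (Fin n) k} → Linked _<_ ns → Linked _<_ (Vec.map suc ns)
Linked-map-suc inc = Linkedₚ.map⁺ (Linked.map s≤s inc)

Linked-zero∷ : {ns : Vec (Fin n) k} → Linked _<_ ns → Linked _<_ (zero ∷ Vec.map suc ns)
Linked-zero∷ {ns = []}    _   = [-]
Linked-zero∷ {ns = _ ∷ _} inc = s≤s z≤n ∷ Linked-map-suc inc

assign-cong : {f f′ : Fin n → A} → f ≗ f′ → (g : Fin n → A) (h : Fin l → A) →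
              assign f g h ≗ assign f′ g h
assign-cong eq g h (x i) = eq i
assign-cong eq g h (y _) = refl
assign-cong eq g h (z _) = refl

-- The entry of t at combine i j is the label of the j-th move at level i.
Agree : Vec A (n * w) → Vec (Fin n) k → (Fin (suc k) → A) → Set
Agree {A} {n} {w} t ns h = (c : Fin n → Fin w) (g : Fin n → A) (i : Fin n) →
  assign (λ j → lookup t (combine j (c j))) g h (ωˣ ns i) ≡ lookup t (combine i (c i))

Agree-++ : (b : Vec A w) {t : Vec A (n * w)} (ns : Vec (Fin n) k) {h : Fin (suc k) → A} →
  Agree t ns h → (c : Fin (suc n) → Fin w) (g : Fin (suc n) → A) (i : Fin n) →
  assign (λ j → lookup (b Vec.++ t) (combine (suc j) (c (suc j)))) (g ∘ suc) h (ωˣ ns i) ≡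
  lookup (b Vec.++ t) (combine (suc i) (c (suc i)))
Agree-++ b {t} ns {h} agree c g i = begin
  assign (λ j → lookup (b Vec.++ t) (combine (suc j) (c (suc j)))) (g ∘ suc) h (ωˣ ns i)
    ≡⟨ assign-cong (λ j → lookup-++ʳ b t (combine j (c (suc j)))) (g ∘ suc) h (ωˣ ns i) ⟩
  assign (λ j → lookup t (combine j (c (suc j)))) (g ∘ suc) h (ωˣ ns i)
    ≡⟨ agree (c ∘ suc) (g ∘ suc) i ⟩
  lookup t (combine i (c (suc i)))
    ≡⟨ lookup-++ʳ b t (combine i (c (suc i))) ⟨
  lookup (b Vec.++ t) (combine (suc i) (c (suc i))) ∎
  where open ≡-Reasoning

module _ {A : Set} (_≟_ : DecidableEquality A) where

  -- The cases are whether `a ∷ b` is free of switches. If it is not, the witness `c` is the last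
  -- entry of `b`, the label that precedes `t`.
  switches-++ : ∀ a (b : Vec A w) (t : Vec A N) →
    ((∀ i → lookup b i ≡ a) × switches _≟_ (a ∷ t) ≤ switches _≟_ (a ∷ b Vec.++ t)) ⊎
    (∃ λ c → suc (switches _≟_ (c ∷ t)) ≤ switches _≟_ (a ∷ b Vec.++ t))
  switches-++ a []      t = inj₁ ((λ ()) , ≤-refl)
  switches-++ a (b ∷ bs) t with a ≟ b
  ... | no _ = inj₂ ([ (λ (_ , le) → b , s≤s le)
                     -- A further switch inside the same block is discarded: one level uses up at
                     -- most one n_j.
                     , (λ (c , le) → c , s≤s (≤-trans (n≤1+n _) le)) ]′ (switches-++ b bs t))
  ... | yes refl with switches-++ a bs t
  ...   | inj₁ (b≡a , le) = inj₁ ((λ { zero → refl ; (suc i) → b≡a i }) , le)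
  ...   | inj₂ switch     = inj₂ switch

  -- Repeating the first entry creates no switch, which supplies the preceding label that
  -- `ω-labelling` expects. The given element serves the empty vector.
  switches-head : A → (t : Vec A N) → ∃ λ a → switches _≟_ (a ∷ t) ≡ switches _≟_ t
  switches-head a []      = a , refl
  switches-head a (b ∷ t) = b ,
    cong (if_then switches _≟_ (b ∷ t) else suc (switches _≟_ (b ∷ t))) (dec-true (b ≟ b) refl)

  -- Here a is the label that precedes t: level 0 becomes one of the n_j exactly
  -- when a switch occurs in it or between it and a.
  ω-labelling : ∀ n a (t : Vec A (n * w)) →
    ∃ λ k → k ≤ switches _≟_ (a ∷ t) × ∃ λ (ns : Vec (Fin n) k) → Linked _<_ ns ×
    ∃ λ (h : Fin (suc k) → A) → h zero ≡ a × Agree t ns h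
  ω-labelling zero a t = 0 , z≤n , [] , [] , const a , refl , λ _ _ ()
  ω-labelling {w} (suc n) a t with splitAt w t
  ... | b , t′ , refl with switches-++ a b t′
  ...   | inj₁ (b≡a , le)
          with k , k≤ , ns , inc , h , h₀ , agree ← ω-labelling n a t′ =
    -- Every label of level 0 is `a`, so this level joins the first interval; its variable z_0 has
    -- the value `a` by the invariant `h zero ≡ a`.
    k , ≤-trans k≤ le , Vec.map suc ns , Linked-map-suc inc , h , h₀ , λ where
      c g zero    → trans (cong (assign _ g h) (ωˣ-map-suc-zero ns))
        (trans h₀ (sym (trans (lookup-++ˡ b t′ (c zero)) (b≡a (c zero)))))
      c g (suc i) → trans (assign-ωˣ-suc _ g ns h i) (Agree-++ b ns agree c g i)
  ...   | inj₂ (a′ , le)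
          with k , k≤ , ns , inc , h , h₀ , agree ← ω-labelling n a′ t′ =
    -- Level 0 becomes n_1, paid for by the switch found. No level precedes it, so z_0 is free to
    -- take the value `a` that the invariant asks for; z_1 now has the value `a′`.
    let h′ = λ { zero → a ; (suc j) → h j } in
    suc k , ≤-trans (s≤s k≤) le , zero ∷ Vec.map suc ns , Linked-zero∷ inc , h′ , refl , λ where
      c g zero    → refl
      c g (suc i) → trans (assign-shift _ g h′ (ωˣ (Vec.map suc ns) (suc i)))
        (trans (assign-ωˣ-suc _ g ns h i) (Agree-++ b ns agree c g i))

-- Winning under a labelling

module _ {A : Set} {a : ℕ} (finite : A ↔ Fin (suc a)) (Γ : Language A) (n : ℕ)
         (Φ : ConjunctiveFormula Γ (Var n 0)) where

  private
    _≟_ : DecidableEquality A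
    _≟_ = inj⇒≟ (↔⇒↣ finite)

    index : A → Fin (suc a)
    index = Inverse.to finite

    element : Fin (suc a) → A
    element = Inverse.from finite

  -- A labelling is a vector with one coordinate for each pair of a level and an element, so
  -- switchability applies to it with N = n * |A|.
  label : Vec A (n * suc a) → Vec A n → Fin n → A
  label s as i = lookup s (combine i (index (lookup as i)))

  Wins : Vec A (n * suc a) → Set
  Wins s = Play A n (λ as bs → satisfies (assign (label s as) (lookup bs) (λ ())) Φ)

  -- Against the same moves, the combined play gives every variable the value of `f` at its m
  -- separate values: through the labels for an x, through the answers for a y.
  Wins-Pol : {f : Operation A m} → Pol Γ f → (ts : Vec (Vec A (n * suc a)) m) →
             (∀ j → Wins (lookup ts j)) → Wins (coordinatewise f ts)
  Wins-Pol {f = f} f∈Pol ts wins = Play-map {n = n}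
    (λ as bs (bss , eq , sat) → satisfies-cong
      (λ { (x i) → sym (lookup-coordinatewise f ts (combine i (index (lookup as i))))
         ; (y i) → sym (eq i)
         ; (z ()) })
      Φ (satisfies-Pol f∈Pol Φ sat))
    (Play-combine {n = n} f
      {λ j as bs → satisfies (assign (label (lookup ts j) as) (lookup bs) (λ ())) Φ} wins)

  module _ {r : ℕ} (holds : ∀ k → k ≤ r → (ns : Vec (Fin n) k) → Linked _<_ ns →
                            Holds _≟ᵛ_ (ω ns (∃∀-prefix n ∙ Φ))) where

    -- The strategy for the ω-sentence is fed labels in place of moves. At a level n_j it reads the
    -- label itself; at any other level it reads a z whose value in `h` is the label.
    Wins-few-switches : ∀ s → switches _≟_ s ≤ r → Wins s
    Wins-few-switches s s≤r
      with a₀ , eq ← switches-head _≟_ (element zero) s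
      with k , k≤ , ns , inc , h , _ , agree ← ω-labelling _≟_ n a₀ s = Play-map
        (λ as bs → satisfies-cong
          (λ { (x i) → trans (assign-cong (lookup∘tabulate (label s as)) (lookup bs) h (ωˣ ns i))
                             (agree (index ∘ lookup as) (lookup bs) i)
             ; (y i) → refl
             ; (z ()) }) Φ)
        (Play-relabel {n = n}
          {λ as bs → satisfies (assign (lookup as) (lookup bs) h ∘ ωᵛ ns) Φ}
          (λ i a → lookup s (combine i (index a)))
          (to (Holds-ω ns Φ)
              (holds k (≤-trans k≤ (≤-trans (≤-reflexive eq) s≤r)) ns inc) h))

    mutual

      Wins-generated : ∀ {s} → Generated (Pol Γ) (λ t → switches _≟_ t ≤ r) s → Wins s
      Wins-generated {s} (generator s≤r)    = Wins-few-switches s s≤r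
      Wins-generated (apply f∈Pol {ts} gen) = Wins-Pol f∈Pol ts (Wins-all gen)

      Wins-all : ∀ {ts : Vec (Vec A (n * suc a)) m} →
                 VecAll.All (Generated (Pol Γ) (λ t → switches _≟_ t ≤ r)) ts →
                 ∀ j → Wins (lookup ts j)
      Wins-all (g VecAll.∷ gs) zero    = Wins-generated g
      Wins-all (g VecAll.∷ gs) (suc j) = Wins-all gs j

    Holds-of-ω : Switchable _≟_ r (Pol Γ) → Holds _≟ᵛ_ (∃∀-prefix n ∙ Φ)
    Holds-of-ω switchable = from (Holds-∃∀ Φ (element zero)) (Play-map
      (λ as bs → satisfies-cong (assign-cong (label-identity as) (lookup bs) (λ ())) Φ)
      (Wins-generated (switchable (n * suc a) identity)))
      where
      identity : Vec A (n * suc a)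
      identity = tabulate (element ∘ proj₂ ∘ remQuot {n} (suc a))
      label-identity : ∀ as → label identity as ≗ lookup as
      label-identity as i = begin
        label identity as i
          ≡⟨ lookup∘tabulate _ (combine i (index (lookup as i))) ⟩
        element (proj₂ (remQuot {n} (suc a) (combine i (index (lookup as i)))))
          ≡⟨ cong (element ∘ proj₂) (remQuot-combine i (index (lookup as i))) ⟩
        element (index (lookup as i))
          ≡⟨ Inverse.strictlyInverseʳ finite (lookup as i) ⟩
        lookup as i ∎
        where open ≡-Reasoning

  ω-of-Holds : Holds _≟ᵛ_ (∃∀-prefix n ∙ Φ) → (ns : Vec (Fin n) k) →
               Holds _≟ᵛ_ (ω ns (∃∀-prefix n ∙ Φ))
  ω-of-Holds holds ns = from (Holds-ω ns Φ) λ h → Play-map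
    (λ as bs → satisfies-cong (agree h as bs) Φ)
    (Play-relabel {n = n} {λ as bs → satisfies (assign (lookup as) (lookup bs) (λ ())) Φ}
      -- The strategy for Ψ is fed the move `b` where `x i` is kept and the value of the z that
      -- replaces it elsewhere. The second `const b` fills the y-slot, which `ωˣ` never hits.
      (λ i b → assign (const b) (const b) h (ωˣ ns i)) (to (Holds-∃∀ Φ (element zero)) holds))
    where
    agree : ∀ h as bs →
      assign (lookup (tabulate λ i → assign (const (lookup as i)) (const (lookup as i)) h (ωˣ ns i)))
             (lookup bs) (λ ()) ≗
      assign (lookup as) (lookup bs) h ∘ ωᵛ ns
    agree h as bs (x i) =
      trans (lookup∘tabulate _ i) (assign-ωˣ ns (lookup as) (lookup bs) h i)
    agree h as bs (y i) = refl
    agree h as bs (z ())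

theorem9 : ∀ {A : Set} {a : ℕ} (finite : A ↔ Fin (suc a)) (Γ : Language A) (r : ℕ) →
    Switchable (inj⇒≟ (↔⇒↣ finite)) r (Pol Γ) →
    ∀ n (Φ : ConjunctiveFormula Γ (Var n 0)) →
    Holds _≟ᵛ_ (∃∀-prefix n ∙ Φ) ⇔
    (∀ k → k ≤ r → (ns : Vec (Fin n) k) → Linked _<_ ns →
    Holds _≟ᵛ_ (ω ns (∃∀-prefix n ∙ Φ)))
theorem9 finite Γ r switchable n Φ = mk⇔
  (λ holds k _ ns _ → ω-of-Holds finite Γ n Φ holds ns)
  (λ holds → Holds-of-ω finite Γ n Φ holds switchable)
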